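{- Let $\Pi$ be a set of substitutions for $\mathcal{X}$ and let $\psi\in E(\mathcal{P})$ be a Boolean formula. If $\langle\psi\rangle_{\sigma_{\mathcal{P}}}=\mathbf{true}$ for every $\sigma_{\mathcal{P}}\in R_{\Pi}$, then the property $\forall\mathcal{X}\,\psi^{*}$ holds for the concrete system, i.e. $\forall\mathcal{X}\,\psi^{*}(s)$ holds for every $s\in R_C$.
   Context: **Logic.** Symbols are Boolean, integer, function (mapping integer tuples to integers) or predicate (mapping integer tuples to Booleans) symbols. CLU expressions are given by: Boolean expressions $b ::= \mathbf{true}\mid\mathbf{false}\mid$ Boolean symbol $\mid\neg b\mid b\wedge b\mid t=t\mid t<t\mid p(t,\dots,t)$; integer expressions $t ::=$ lambda-bound variable $\mid$ integer symbol $\mid \mathit{ITE}(b,t,t)$ (if-then-else) $\mid t+c$ ($c$ an integer constant) $\mid f(t,\dots,t)$; predicate expressions $p ::=$ predicate symbol $\mid\lambda x_1,\dots,x_k.\,b$; function expressions $f ::=$ function symbol $\mid \lambda x_1,\dots,x_k.\,t$ (lambda variables are integers). For a set of symbols $\mathcal{A}$, $E(\mathcal{A})$ is the set of CLU expressions over $\mathcal{A}$; $\Sigma_{\mathcal{A}}$ is the set of interpretations $\sigma_{\mathcal{A}}$, each assigning to every symbol of $\mathcal{A}$ a value of the appropriate type; $\langle\theta\rangle_{\sigma_{\mathcal{A}}}$ is the value of $\theta\in E(\mathcal{A})$ under $\sigma_{\mathcal{A}}$. For disjoint $\mathcal{A},\mathcal{B}$, $\sigma_{\mathcal{A}}\cdot\sigma_{\mathcal{B}}$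 is the combined interpretation of $\mathcal{A}\cup\mathcal{B}$. A named set $v$ over $\mathcal{A}$ of expressions over $\mathcal{B}$ has an expression $v_x\in E(\mathcal{B})$ of the type of $x$ for each $x\in\mathcal{A}$; $\langle v\rangle_{\sigma_{\mathcal{B}}}\in\Sigma_{\mathcal{A}}$ is the interpretation $x\mapsto\langle v_x\rangle_{\sigma_{\mathcal{B}}}$. $\theta[v/\mathcal{A}]$ is the result of simultaneously replacing each $x\in\mathcal{A}$ in $\theta$ by $v_x$ (applied componentwise if $\theta$ is a named set). **Concrete system.** Pairwise disjoint symbol sets: state symbols $\mathcal{V}$, initial-state symbols $\mathcal{J}$, input symbols $\mathcal{I}$, index symbols $\mathcal{X}$, and a finite set $\mathcal{P}$ of Boolean predicate symbols. The system is given by expressions $q^0_x\in E(\mathcal{J})$ and $\delta_x\in E(\mathcal{V}\cup\mathcal{I})$ for each $x\in\mathcal{V}$. Concrete states are elements of $\Sigma_{\mathcal{V}}$; $Q^0_C=\{\langle q^0\rangle_{\sigma_{\mathcal{J}}}\mid\sigma_{\mathcal{J}}\in\Sigma_{\mathcal{J}}\}$; $N_C(s)=\{\langle\delta\rangle_{s\cdot\sigma_{\mathcal{I}}}\mid\sigma_{\mathcal{I}}\in\Sigma_{\mathcal{I}}\}$. $R_C$ is the set of reachable states: those $s$ for which there is a sequence $s_0,\dots,s_n=s$ with $s_0\in Q^0_C$ and $s_{i+1}\in N_C(s_i)$ for $0\le i<n$. **Abstraction.** For each $p\in\mathcal{P}$ there is a Boolean expression $\phi_p\in E(\mathcal{V}\cup\mathcal{X})$;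 $\phi$ is the named set of these, so $\langle\phi\rangle_{s\cdot\sigma_{\mathcal{X}}}\in\Sigma_{\mathcal{P}}$. Abstract states are elements of $\Sigma_{\mathcal{P}}$. $\alpha(s)=\{\langle\phi\rangle_{s\cdot\sigma_{\mathcal{X}}}\mid\sigma_{\mathcal{X}}\in\Sigma_{\mathcal{X}}\}$, $\alpha(S_C)=\bigcup_{s\in S_C}\alpha(s)$, and $Q^0_A=\alpha(Q^0_C)$. **Quantifier instantiation.** A substitution $\pi$ for $\mathcal{X}$ assigns an expression $\pi_x\in E(\mathcal{V}\cup\mathcal{X}\cup\mathcal{I})$ to each $x\in\mathcal{X}$. For a set $\Pi$ of such substitutions, $\sigma_{\mathcal{X}}\in\Sigma_{\mathcal{X}}$, $\sigma_{\mathcal{I}}\in\Sigma_{\mathcal{I}}$, and $S_A\subseteq\Sigma_{\mathcal{P}}$, $\gamma_{\Pi}(S_A,\sigma_{\mathcal{X}},\sigma_{\mathcal{I}})=\{s\in\Sigma_{\mathcal{V}}\mid\forall\pi\in\Pi:\langle\phi[\pi/\mathcal{X}]\rangle_{s\cdot\sigma_{\mathcal{X}}\cdot\sigma_{\mathcal{I}}}\in S_A\}$. Define $N_{\Pi}(S_A)=\{\langle\phi[\delta/\mathcal{V}]\rangle_{s\cdot\sigma_{\mathcal{X}}\cdot\sigma_{\mathcal{I}}}\mid\sigma_{\mathcal{X}}\in\Sigma_{\mathcal{X}},\sigma_{\mathcal{I}}\in\Sigma_{\mathcal{I}},s\in\gamma_{\Pi}(S_A,\sigma_{\mathcal{X}},\sigma_{\mathcal{I}})\}$,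 $R_{\Pi}^0=Q_A^0$, $R_{\Pi}^{i+1}=R_{\Pi}^i\cup N_{\Pi}(R_{\Pi}^i)$; $R_{\Pi}$ is the set to which these iterations converge (convergence holds since $\Sigma_{\mathcal{P}}$ is finite). **Properties.** For a Boolean formula $\psi\in E(\mathcal{P})$, $\psi^{*}=\psi[\phi/\mathcal{P}]\in E(\mathcal{V}\cup\mathcal{X})$. For a concrete state $s$, $\forall\mathcal{X}\,\psi^{*}(s)$ holds when $\langle\psi^{*}\rangle_{s\cdot\sigma_{\mathcal{X}}}=\mathbf{true}$ for every $\sigma_{\mathcal{X}}\in\Sigma_{\mathcal{X}}$. -}

module Defs where

open import Level using (0ℓ)
open import Data.Bool.Base using (Bool; true; false; not; _∧_; if_then_else_)
open import Data.Fin.Base using (Fin; zero; suc; inject₁; fromℕ; lift)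
open import Data.Integer.Base using (ℤ) renaming (_+_ to _+ℤ_)
open import Data.Integer.Properties using (_≟_; _<?_)
open import Data.Nat.Base using (ℕ; zero; suc; _+_; _≤_)
open import Data.Product.Base using (∃-syntax; Σ-syntax; _×_)
open import Data.Sum.Base using (_⊎_; inj₁; inj₂)
open import Data.Vec.Base using (Vec; []; _∷_; _++_; lookup)
open import Relation.Binary.PropositionalEquality using (_≡_)
open import Relation.Nullary.Decidable using (⌊_⌋)
open import Relation.Unary using (Pred; _∈_; _∪_; _≐_)

data Sort : Set where
  bool int  : Sort
  func pred : ℕ → Sort

Value : Sort → Set
Value bool     = Bool
Value int      = ℤ
Value (func k) = Vec ℤ k → ℤ
Value (pred k) = Vec ℤ k → Bool

-- Functions are identified when they agree on all integer tuples.
ValueEq : ∀ τ → Value τ → Value τ → Set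
ValueEq bool     a b = a ≡ b
ValueEq int      a b = a ≡ b
ValueEq (func k) f g = ∀ xs → f xs ≡ g xs
ValueEq (pred k) f g = ∀ xs → f xs ≡ g xs

-- A set of symbols, presented as the family of its symbols of each sort.
Symbols : Set₁
Symbols = Sort → Set

-- Tagging makes the symbol sets being united disjoint.
infixr 6 _⊎ˢ_
_⊎ˢ_ : Symbols → Symbols → Symbols
(A ⊎ˢ B) τ = A τ ⊎ B τ

-- Expr A n τ: CLU expressions of sort τ over A whose free lambda-bound
-- variables are among n de Bruijn indices.  A lambda of arity k binds the k
-- lowest indices of its body, in the order of the argument tuple.
infix  9 `¬_
infixr 6 _`∧_
infix  7 _`=_ _`<_
infixl 8 _`+_

data Expr (A : Symbols) (n : ℕ) : Sort → Set where
  symb          : ∀ {τ} → A τ → Expr A n τ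
  `true `false  : Expr A n bool
  `¬_           : Expr A n bool → Expr A n bool
  _`∧_          : Expr A n bool → Expr A n bool → Expr A n bool
  _`=_ _`<_     : Expr A n int → Expr A n int → Expr A n bool
  papp          : ∀ {k} → Expr A n (pred k) → Vec (Expr A n int) k → Expr A n bool
  var           : Fin n → Expr A n int
  ITE           : Expr A n bool → Expr A n int → Expr A n int → Expr A n int
  _`+_          : Expr A n int → ℤ → Expr A n int
  fapp          : ∀ {k} → Expr A n (func k) → Vec (Expr A n int) k → Expr A n int
  plam          : ∀ k → Expr A (k + n) bool → Expr A n (pred k)
  flam          : ∀ k → Expr A (k + n) int → Expr A n (func k)

-- The expressions over A proper have no unbound lambda variable.
E : Symbols → Sort → Set
E A τ = Expr A 0 τ

Interp : Symbols → Set
Interp A = ∀ τ → A τ → Value τ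

infix 4 _≈_
_≈_ : ∀ {A} → Interp A → Interp A → Set
_≈_ {A} σ σ′ = ∀ τ (x : A τ) → ValueEq τ (σ τ x) (σ′ τ x)

infixr 7 _·_
_·_ : ∀ {A B} → Interp A → Interp B → Interp (A ⊎ˢ B)
(σ · σ′) τ (inj₁ x) = σ τ x
(σ · σ′) τ (inj₂ y) = σ′ τ y

mutual
  eval : ∀ {A n τ} → Expr A n τ → Interp A → Vec ℤ n → Value τ
  eval (symb x)    σ ρ = σ _ x
  eval `true       σ ρ = true
  eval `false      σ ρ = false
  eval (`¬ b)      σ ρ = not (eval b σ ρ)
  eval (b `∧ c)    σ ρ = eval b σ ρ ∧ eval c σ ρ
  eval (t `= u)    σ ρ = ⌊ eval t σ ρ ≟ eval u σ ρ ⌋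
  eval (t `< u)    σ ρ = ⌊ eval t σ ρ <? eval u σ ρ ⌋
  eval (papp p ts) σ ρ = eval p σ ρ (evals ts σ ρ)
  eval (var i)     σ ρ = lookup ρ i
  eval (ITE b t u) σ ρ = if eval b σ ρ then eval t σ ρ else eval u σ ρ
  eval (t `+ c)    σ ρ = eval t σ ρ +ℤ c
  eval (fapp f ts) σ ρ = eval f σ ρ (evals ts σ ρ)
  eval (plam k b)  σ ρ = λ xs → eval b σ (xs ++ ρ)
  eval (flam k t)  σ ρ = λ xs → eval t σ (xs ++ ρ)

  evals : ∀ {A n k} → Vec (Expr A n int) k → Interp A → Vec ℤ n → Vec ℤ k
  evals []       σ ρ = []
  evals (t ∷ ts) σ ρ = eval t σ ρ ∷ evals ts σ ρ

⟨_⟩ : ∀ {A τ} → E A τ → Interp A → Value τ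
⟨ θ ⟩ σ = eval θ σ []

Named : Symbols → Symbols → Set
Named A B = ∀ τ → A τ → E B τ

⟨_⟩ˢ : ∀ {A B} → Named A B → Interp B → Interp A
⟨ v ⟩ˢ σ τ x = ⟨ v τ x ⟩ σ

mutual
  rename : ∀ {A m n τ} → (Fin m → Fin n) → Expr A m τ → Expr A n τ
  rename ρ (symb x)    = symb x
  rename ρ `true       = `true
  rename ρ `false      = `false
  rename ρ (`¬ b)      = `¬ rename ρ b
  rename ρ (b `∧ c)    = rename ρ b `∧ rename ρ c
  rename ρ (t `= u)    = rename ρ t `= rename ρ u
  rename ρ (t `< u)    = rename ρ t `< rename ρ u
  rename ρ (papp p ts) = papp (rename ρ p) (renames ρ ts)
  rename ρ (var i)     = var (ρ i)
  rename ρ (ITE b t u) = ITE (rename ρ b) (rename ρ t) (rename ρ u)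
  rename ρ (t `+ c)    = rename ρ t `+ c
  rename ρ (fapp f ts) = fapp (rename ρ f) (renames ρ ts)
  rename ρ (plam k b)  = plam k (rename (lift k ρ) b)
  rename ρ (flam k t)  = flam k (rename (lift k ρ) t)

  renames : ∀ {A m n k} → (Fin m → Fin n) → Vec (Expr A m int) k → Vec (Expr A n int) k
  renames ρ []       = []
  renames ρ (t ∷ ts) = rename ρ t ∷ renames ρ ts

infixl 10 _[_] _[_]ˢ

mutual
  _[_] : ∀ {A B n τ} → Expr A n τ → Named A B → Expr B n τ
  symb x    [ v ] = rename (λ ()) (v _ x)
  `true     [ v ] = `true
  `false    [ v ] = `false
  (`¬ b)    [ v ] = `¬ (b [ v ])
  (b `∧ c)  [ v ] = (b [ v ]) `∧ (c [ v ])
  (t `= u)  [ v ] = (t [ v ]) `= (u [ v ])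
  (t `< u)  [ v ] = (t [ v ]) `< (u [ v ])
  papp p ts [ v ] = papp (p [ v ]) (substs ts v)
  var i     [ v ] = var i
  ITE b t u [ v ] = ITE (b [ v ]) (t [ v ]) (u [ v ])
  (t `+ c)  [ v ] = (t [ v ]) `+ c
  fapp f ts [ v ] = fapp (f [ v ]) (substs ts v)
  plam k b  [ v ] = plam k (b [ v ])
  flam k t  [ v ] = flam k (t [ v ])

  substs : ∀ {A B n k} → Vec (Expr A n int) k → Named A B → Vec (Expr B n int) k
  substs []       v = []
  substs (t ∷ ts) v = t [ v ] ∷ substs ts v

_[_]ˢ : ∀ {A B C} → Named A B → Named B C → Named A C
(w [ v ]ˢ) τ x = w τ x [ v ]

-- A substitution for only some symbols of an expression is completed by
-- `keep` on the others; `keep` also serves for the inclusion E(A) ⊆ E(B), A ⊆ B.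
keep : ∀ {A B} → (∀ τ → A τ → B τ) → Named A B
keep ι τ x = symb (ι τ x)

infixr 5 _∥_
_∥_ : ∀ {A B C} → Named A C → Named B C → Named (A ⊎ˢ B) C
(v ∥ w) τ (inj₁ x) = v τ x
(v ∥ w) τ (inj₂ y) = w τ y

record System : Set₁ where
  field
    𝒱 𝒥 ℐ : Symbols
    q⁰    : Named 𝒱 𝒥
    δ     : Named 𝒱 (𝒱 ⊎ˢ ℐ)

  State : Set
  State = Interp 𝒱

  Q⁰C : Pred State 0ℓ
  Q⁰C s = ∃[ σJ ] s ≈ ⟨ q⁰ ⟩ˢ σJ

  NC : State → Pred State 0ℓ
  NC s s′ = ∃[ σI ] s′ ≈ ⟨ δ ⟩ˢ (s · σI)

  RC : Pred State 0ℓ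
  RC s = ∃[ n ] Σ[ seq ∈ (Fin (suc n) → State) ]
           seq zero ∈ Q⁰C
         × (∀ (i : Fin n) → seq (suc i) ∈ NC (seq (inject₁ i)))
         × seq (fromℕ n) ≈ s

data BoolSym (m : ℕ) : Symbols where
  bsym : Fin m → BoolSym m bool

record Abstraction (C : System) : Set₁ where
  open System C
  field
    𝒳 : Symbols
    m : ℕ

  𝒫 : Symbols
  𝒫 = BoolSym m

  field
    φ : Named 𝒫 (𝒱 ⊎ˢ 𝒳)

module PredicateAbstraction (C : System) (A : Abstraction C) where
  open System C public
  open Abstraction A public

  AbsState : Set
  AbsState = Interp 𝒫

  α : State → Pred AbsState 0ℓ
  α s a = ∃[ σX ] a ≈ ⟨ φ ⟩ˢ (s · σX)

  αs : Pred State 0ℓ → Pred AbsState 0ℓ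
  αs S a = ∃[ s ] s ∈ S × a ∈ α s

  Q⁰A : Pred AbsState 0ℓ
  Q⁰A = αs Q⁰C

  Substitution : Set
  Substitution = Named 𝒳 (𝒱 ⊎ˢ 𝒳 ⊎ˢ ℐ)

  φ[_/𝒳] : Substitution → Named 𝒫 (𝒱 ⊎ˢ 𝒳 ⊎ˢ ℐ)
  φ[ π /𝒳] = φ [ keep (λ _ → inj₁) ∥ π ]ˢ

  φ[δ/𝒱] : Named 𝒫 (𝒱 ⊎ˢ 𝒳 ⊎ˢ ℐ)
  φ[δ/𝒱] = φ [ δ′ ∥ keep (λ _ x → inj₂ (inj₁ x)) ]ˢ
    where
    δ′ : Named 𝒱 (𝒱 ⊎ˢ 𝒳 ⊎ˢ ℐ)
    δ′ = δ [ keep (λ _ → inj₁) ∥ keep (λ _ i → inj₂ (inj₂ i)) ]ˢ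

  γ : Pred Substitution 0ℓ → Pred AbsState 0ℓ → Interp 𝒳 → Interp ℐ → Pred State 0ℓ
  γ Π S σX σI s = ∀ π → π ∈ Π → ⟨ φ[ π /𝒳] ⟩ˢ (s · σX · σI) ∈ S

  N : Pred Substitution 0ℓ → Pred AbsState 0ℓ → Pred AbsState 0ℓ
  N Π S a = ∃[ σX ] ∃[ σI ] ∃[ s ] s ∈ γ Π S σX σI × a ≈ ⟨ φ[δ/𝒱] ⟩ˢ (s · σX · σI)

  Rⁱ : Pred Substitution 0ℓ → ℕ → Pred AbsState 0ℓ
  Rⁱ Π zero    = Q⁰A
  Rⁱ Π (suc i) = Rⁱ Π i ∪ N Π (Rⁱ Π i)

  -- The eventually constant value of the iteration.  That a stable stage
  -- exists (classically, because 𝒫 is finite) is not assumed.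
  R : Pred Substitution 0ℓ → Pred AbsState 0ℓ
  R Π a = ∃[ n ] (∀ i → n ≤ i → Rⁱ Π i ≐ Rⁱ Π n) × a ∈ Rⁱ Π n

  _* : E 𝒫 bool → E (𝒱 ⊎ˢ 𝒳) bool
  ψ * = ψ [ φ ]

  ∀𝒳 : E (𝒱 ⊎ˢ 𝒳) bool → State → Set
  ∀𝒳 θ s = ∀ σX → ⟨ θ ⟩ (s · σX) ≡ true

{-# OPTIONS --safe #-}
-- Soundness: the successor of a concrete state s under the input σI is abstracted,
-- for every σX, by φ[δ/𝒱] at s · σX · σI, and s lies in γ because α(s) contains
-- the value of φ[π/𝒳] for each π.  So α(s) is contained in some Rⁱ for every
-- reachable s.
--
-- Constructively the iteration cannot be shown to become stable, since membership
-- in Rⁱ is undecidable, but it does so up to double negation: excluded middle is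
-- used once per valuation of 𝒫, and there are finitely many.  The conclusion is an
-- equation between Booleans, hence stable under double negation.
module Submission where

open import Defs
open import Level using (0ℓ)
open import Data.Bool.Base using (Bool; true; false; not; _∧_; if_then_else_)
open import Data.Bool.Properties using () renaming (_≟_ to _≟ᵇ_)
open import Data.Empty using (⊥-elim)
open import Data.Fin.Base using (Fin; zero; suc; fromℕ; inject₁; lift)
open import Data.Integer.Base using (ℤ) renaming (_+_ to _+ℤ_)
open import Data.Integer.Properties using (_≟_; _<?_)
open import Data.Nat.Base using (ℕ; zero; suc; _≤_; _⊔_; _≤′_; ≤′-refl; ≤′-step)
open import Data.Nat.Properties using (≤⇒≤′; m≤m⊔n; m≤n⊔m)
open import Data.Product.Base using (∃-syntax; _,_)
open import Data.Sum.Base using (inj₁; inj₂)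
open import Data.Vec.Base using (Vec; []; _∷_; _++_; lookup; tabulate)
open import Data.Vec.Properties using (lookup∘tabulate)
open import Function.Base using (_∘_)
open import Relation.Binary.PropositionalEquality using (_≡_; refl; sym; trans; cong; cong₂)
open import Relation.Nullary using (¬_)
open import Relation.Nullary.Decidable using (⌊_⌋; decidable-stable)
open import Relation.Unary using (Pred; _∈_; _⊆_)

ValueEq-refl : ∀ τ {x} → ValueEq τ x x
ValueEq-refl bool     = refl
ValueEq-refl int      = refl
ValueEq-refl (func k) = λ _ → refl
ValueEq-refl (pred k) = λ _ → refl

ValueEq-sym : ∀ τ {x y} → ValueEq τ x y → ValueEq τ y x
ValueEq-sym bool     p = sym p
ValueEq-sym int      p = sym p
ValueEq-sym (func k) p = sym ∘ p
ValueEq-sym (pred k) p = sym ∘ p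

ValueEq-trans : ∀ τ {x y z} → ValueEq τ x y → ValueEq τ y z → ValueEq τ x z
ValueEq-trans bool     p q = trans p q
ValueEq-trans int      p q = trans p q
ValueEq-trans (func k) p q = λ xs → trans (p xs) (q xs)
ValueEq-trans (pred k) p q = λ xs → trans (p xs) (q xs)

≈-refl : ∀ {A} {σ : Interp A} → σ ≈ σ
≈-refl τ x = ValueEq-refl τ

≈-sym : ∀ {A} {σ σ′ : Interp A} → σ ≈ σ′ → σ′ ≈ σ
≈-sym e τ x = ValueEq-sym τ (e τ x)

≈-trans : ∀ {A} {σ σ′ σ″ : Interp A} → σ ≈ σ′ → σ′ ≈ σ″ → σ ≈ σ″
≈-trans e f τ x = ValueEq-trans τ (e τ x) (f τ x)

·-cong : ∀ {A B} {σ σ′ : Interp A} {υ υ′ : Interp B} → σ ≈ σ′ → υ ≈ υ′ → σ · υ ≈ σ′ · υ′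
·-cong e f τ (inj₁ x) = e τ x
·-cong e f τ (inj₂ y) = f τ y

lookup-lift : ∀ {m n k} (r : Fin m → Fin n) {ρ : Vec ℤ m} {ρ′ : Vec ℤ n} →
  (∀ i → lookup ρ′ (r i) ≡ lookup ρ i) →
  (xs : Vec ℤ k) → ∀ i → lookup (xs ++ ρ′) (lift k r i) ≡ lookup (xs ++ ρ) i
lookup-lift r e []       i       = e i
lookup-lift r e (x ∷ xs) zero    = refl
lookup-lift r e (x ∷ xs) (suc i) = lookup-lift r e xs i

if-cong : {X : Set} {b b′ : Bool} {x x′ y y′ : X} → b ≡ b′ → x ≡ x′ → y ≡ y′ →
  (if b then x else y) ≡ (if b′ then x′ else y′)
if-cong refl refl refl = refl

mutual
  eval-rename : ∀ {A m n τ} (t : Expr A m τ) {r : Fin m → Fin n} {σ} {ρ : Vec ℤ m} {ρ′ : Vec ℤ n} →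
    (∀ i → lookup ρ′ (r i) ≡ lookup ρ i) → ValueEq τ (eval (rename r t) σ ρ′) (eval t σ ρ)
  eval-rename (symb x)    e = ValueEq-refl _
  eval-rename `true       e = refl
  eval-rename `false      e = refl
  eval-rename (`¬ b)      e = cong not (eval-rename b e)
  eval-rename (b `∧ c)    e = cong₂ _∧_ (eval-rename b e) (eval-rename c e)
  eval-rename (t `= u)    e = cong₂ (λ x y → ⌊ x ≟ y ⌋) (eval-rename t e) (eval-rename u e)
  eval-rename (t `< u)    e = cong₂ (λ x y → ⌊ x <? y ⌋) (eval-rename t e) (eval-rename u e)
  -- `ValueEq` at a predicate sort is pointwise equality, so the predicate is changed first, at
  -- fixed arguments, and the arguments afterwards.
  eval-rename (papp p ts) {σ = σ} {ρ} e = trans (eval-rename p e _) (cong (eval p σ ρ) (evals-renames ts e))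
  eval-rename (var i)     e = e i
  eval-rename (ITE b t u) e = if-cong (eval-rename b e) (eval-rename t e) (eval-rename u e)
  eval-rename (t `+ c)    e = cong (_+ℤ c) (eval-rename t e)
  eval-rename (fapp f ts) {σ = σ} {ρ} e = trans (eval-rename f e _) (cong (eval f σ ρ) (evals-renames ts e))
  eval-rename (plam k b)  e = λ xs → eval-rename b (lookup-lift _ e xs)
  eval-rename (flam k t)  e = λ xs → eval-rename t (lookup-lift _ e xs)

  evals-renames : ∀ {A m n k} (ts : Vec (Expr A m int) k) {r : Fin m → Fin n} {σ} {ρ : Vec ℤ m} {ρ′ : Vec ℤ n} →
    (∀ i → lookup ρ′ (r i) ≡ lookup ρ i) → evals (renames r ts) σ ρ′ ≡ evals ts σ ρ
  evals-renames []       e = refl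
  evals-renames (t ∷ ts) e = cong₂ _∷_ (eval-rename t e) (evals-renames ts e)

mutual
  -- Without function extensionality `⟨ v ⟩ˢ σ` is only pointwise equal to a combined interpretation
  -- such as `s · σX`. Taking any `σ′` up to `≈` lets the lemma apply to both forms.
  eval-subst : ∀ {A B n τ} (t : Expr A n τ) {v : Named A B} {σ σ′} {ρ : Vec ℤ n} →
    ⟨ v ⟩ˢ σ ≈ σ′ → ValueEq τ (eval (t [ v ]) σ ρ) (eval t σ′ ρ)
  -- The inserted expression is closed, so its value does not depend on `ρ` and the condition on
  -- renamed variables is vacuous.
  eval-subst (symb x)    {v} e = ValueEq-trans _ (eval-rename (v _ x) λ ()) (e _ x)
  eval-subst `true       e = refl
  eval-subst `false      e = refl
  eval-subst (`¬ b)      e = cong not (eval-subst b e)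
  eval-subst (b `∧ c)    e = cong₂ _∧_ (eval-subst b e) (eval-subst c e)
  eval-subst (t `= u)    e = cong₂ (λ x y → ⌊ x ≟ y ⌋) (eval-subst t e) (eval-subst u e)
  eval-subst (t `< u)    e = cong₂ (λ x y → ⌊ x <? y ⌋) (eval-subst t e) (eval-subst u e)
  eval-subst (papp p ts) {σ′ = σ′} {ρ} e = trans (eval-subst p e _) (cong (eval p σ′ ρ) (evals-substs ts e))
  eval-subst (var i)     e = refl
  eval-subst (ITE b t u) e = if-cong (eval-subst b e) (eval-subst t e) (eval-subst u e)
  eval-subst (t `+ c)    e = cong (_+ℤ c) (eval-subst t e)
  eval-subst (fapp f ts) {σ′ = σ′} {ρ} e = trans (eval-subst f e _) (cong (eval f σ′ ρ) (evals-substs ts e))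
  eval-subst (plam k b)  e = λ xs → eval-subst b e
  eval-subst (flam k t)  e = λ xs → eval-subst t e

  evals-substs : ∀ {A B n k} (ts : Vec (Expr A n int) k) {v : Named A B} {σ σ′} {ρ : Vec ℤ n} →
    ⟨ v ⟩ˢ σ ≈ σ′ → evals (substs ts v) σ ρ ≡ evals ts σ′ ρ
  evals-substs []       e = refl
  evals-substs (t ∷ ts) e = cong₂ _∷_ (eval-subst t e) (evals-substs ts e)

-- Both sides are compared with the value of t under the identity substitution.
eval-cong : ∀ {A n τ} (t : Expr A n τ) {σ σ′} {ρ : Vec ℤ n} → σ ≈ σ′ → ValueEq τ (eval t σ ρ) (eval t σ′ ρ)
eval-cong {τ = τ} t {σ} e =
  ValueEq-trans τ (ValueEq-sym τ (eval-subst t {v = keep λ _ x → x} ≈-refl)) (eval-subst t e)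

⟨⟩ˢ-cong : ∀ {A B} (w : Named A B) {σ σ′} → σ ≈ σ′ → ⟨ w ⟩ˢ σ ≈ ⟨ w ⟩ˢ σ′
⟨⟩ˢ-cong w e τ x = eval-cong (w τ x) e

⟨⟩ˢ-subst : ∀ {A B C} (w : Named A B) {v : Named B C} {σ σ′} →
  ⟨ v ⟩ˢ σ ≈ σ′ → ⟨ w [ v ]ˢ ⟩ˢ σ ≈ ⟨ w ⟩ˢ σ′
⟨⟩ˢ-subst w e τ x = eval-subst (w τ x) e

⟨∥⟩ˢ : ∀ {A B C} {v : Named A C} {w : Named B C} {σ σ₁ σ₂} →
  ⟨ v ⟩ˢ σ ≈ σ₁ → ⟨ w ⟩ˢ σ ≈ σ₂ → ⟨ v ∥ w ⟩ˢ σ ≈ σ₁ · σ₂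
⟨∥⟩ˢ e f τ (inj₁ x) = e τ x
⟨∥⟩ˢ e f τ (inj₂ y) = f τ y

¬¬-bind : {P Q : Set} → ¬ ¬ P → (P → ¬ ¬ Q) → ¬ ¬ Q
¬¬-bind p f ¬q = p λ x → f x ¬q

Monotone : {X : Set} → (ℕ → Pred X 0ℓ) → Set
Monotone P = ∀ {i j} → i ≤ j → P i ⊆ P j

-- Induction on the length: the vectors starting with `true` and those starting with `false` each
-- have a stable stage, and by monotonicity the larger of the two serves for both.
¬¬-stable-Vec : ∀ {m} (P : ℕ → Pred (Vec Bool m) 0ℓ) → Monotone P → ¬ ¬ (∃[ n ] ∀ i → P i ⊆ P n)
¬¬-stable-Vec {zero} P mono ¬s =
  -- Stage 0 is proposed first; should the empty vector turn up at some stage `i`, then `i` itself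
  -- is stable.
  ¬s (0 , λ { i {[]} p → ⊥-elim (¬s (i , λ { _ {[]} _ → p })) })
¬¬-stable-Vec {suc m} P mono =
  ¬¬-bind (half true) λ (a , p) → ¬¬-bind (half false) λ (b , q) ¬s →
  ¬s (a ⊔ b , λ { i {true ∷ v} r → mono (m≤m⊔n a b) (p i r)
                ; i {false ∷ v} r → mono (m≤n⊔m a b) (q i r) })
  where
  half : ∀ x → ¬ ¬ (∃[ n ] ∀ i → (P i ∘ (x ∷_)) ⊆ (P n ∘ (x ∷_)))
  half x = ¬¬-stable-Vec (λ i → P i ∘ (x ∷_)) λ i≤j → mono i≤j

valuation : ∀ {m} → Vec Bool m → Interp (BoolSym m)
valuation v .bool (bsym i) = lookup v i

valuation-surjective : ∀ {m} (σ : Interp (BoolSym m)) → valuation (tabulate (λ i → σ bool (bsym i))) ≈ σ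
valuation-surjective σ .bool (bsym i) = lookup∘tabulate (λ j → σ bool (bsym j)) i

module _ (C : System) (A : Abstraction C) where
  open PredicateAbstraction C A

  module _ (Π : Pred Substitution 0ℓ) where

    -- Needed because an abstract state is recovered from its vector of truth values only up to `≈`.
    Rⁱ-resp-≈ : ∀ i {a b} → a ≈ b → a ∈ Rⁱ Π i → b ∈ Rⁱ Π i
    Rⁱ-resp-≈ zero    e (s , s∈Q , σX , a≈)     = s , s∈Q , σX , ≈-trans (≈-sym e) a≈
    Rⁱ-resp-≈ (suc i) e (inj₁ a∈R)              = inj₁ (Rⁱ-resp-≈ i e a∈R)
    Rⁱ-resp-≈ (suc i) e (inj₂ (σX , σI , s , s∈γ , a≈)) = inj₂ (σX , σI , s , s∈γ , ≈-trans (≈-sym e) a≈)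

    Rⁱ-monotone : Monotone (Rⁱ Π)
    Rⁱ-monotone i≤j = go (≤⇒≤′ i≤j)
      where
      go : ∀ {i j} → i ≤′ j → Rⁱ Π i ⊆ Rⁱ Π j
      go ≤′-refl        a∈R = a∈R
      go (≤′-step i≤′j) a∈R = inj₁ (go i≤′j a∈R)

    ¬¬-Rⁱ-stable : ¬ ¬ (∃[ n ] ∀ i → Rⁱ Π i ⊆ Rⁱ Π n)
    ¬¬-Rⁱ-stable = ¬¬-bind
      (¬¬-stable-Vec (λ i v → valuation v ∈ Rⁱ Π i) λ i≤j → Rⁱ-monotone i≤j)
      λ (n , p) ¬s → ¬s (n , λ i {a} a∈R →
        Rⁱ-resp-≈ n (valuation-surjective a) (p i (Rⁱ-resp-≈ i (≈-sym (valuation-surjective a)) a∈R)))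

    -- The bound covers every stage, so it yields one half of the equality beyond `n` (monotonicity
    -- gives the other) and also moves stage `k` into stage `n`.
    stable⇒Rⁱ⊆R : (∃[ n ] ∀ i → Rⁱ Π i ⊆ Rⁱ Π n) → ∀ k → Rⁱ Π k ⊆ R Π
    stable⇒Rⁱ⊆R (n , p) k a∈R = n , (λ i n≤i → (λ {_} → p i) , Rⁱ-monotone n≤i) , p k a∈R

    α-step : ∀ {k s s′} → s′ ∈ NC s → α s ⊆ Rⁱ Π k → α s′ ⊆ Rⁱ Π (suc k)
    α-step {k} {s} (σI , s′≈) αs⊆R {a} (σX , a≈) =
      inj₂ (σX , σI , s , s∈γ , ≈-trans a≈ (≈-trans (⟨⟩ˢ-cong φ (·-cong s′≈ ≈-refl)) (≈-sym φ[δ]≈)))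
      where
      s∈γ : s ∈ γ Π (Rⁱ Π k) σX σI
      -- The value of `π` at `s · σX · σI` is the index interpretation witnessing membership in
      -- `α s`.
      s∈γ π π∈Π = αs⊆R (⟨ π ⟩ˢ (s · σX · σI) , ⟨⟩ˢ-subst φ (⟨∥⟩ˢ ≈-refl ≈-refl))

      φ[δ]≈ : ⟨ φ[δ/𝒱] ⟩ˢ (s · σX · σI) ≈ ⟨ φ ⟩ˢ (⟨ δ ⟩ˢ (s · σI) · σX)
      -- The inner substitution embeds `δ` into the larger symbol set, where its value ignores `σX`;
      -- the outer one puts the next state into `φ`.
      φ[δ]≈ = ⟨⟩ˢ-subst φ (⟨∥⟩ˢ (⟨⟩ˢ-subst δ (⟨∥⟩ˢ ≈-refl ≈-refl)) ≈-refl)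

    -- The starting stage `k` is arbitrary so that the induction can drop the first state: the
    -- remaining run starts at stage `suc k`.
    α-run : ∀ {k} n (seq : Fin (suc n) → State) →
      (∀ (i : Fin n) → seq (suc i) ∈ NC (seq (inject₁ i))) →
      α (seq zero) ⊆ Rⁱ Π k → ∃[ l ] α (seq (fromℕ n)) ⊆ Rⁱ Π l
    α-run {k} zero    seq steps base = k , base
    α-run {k} (suc n) seq steps base =
      α-run {suc k} n (seq ∘ suc) (steps ∘ suc) (α-step {k} (steps zero) base)

    α-reachable : ∀ {s} → s ∈ RC → ∃[ l ] α s ⊆ Rⁱ Π l
    α-reachable (n , seq , init , steps , end≈)
      with l , p ← α-run {0} n seq steps (λ (σX , a≈) → seq zero , init , σX , a≈) =
      l , λ (σX , a≈) → p (σX , ≈-trans a≈ (⟨⟩ˢ-cong φ (·-cong (≈-sym end≈) ≈-refl)))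

theorem8p4 : (C : System) (A : Abstraction C) →
    let open PredicateAbstraction C A in
    (Π : Pred Substitution 0ℓ) (ψ : E 𝒫 bool) →
    (∀ σ → σ ∈ R Π → ⟨ ψ ⟩ σ ≡ true) →
    ∀ s → s ∈ RC → ∀𝒳 (ψ *) s
theorem8p4 C A Π ψ ψ-holds s s∈RC σX with α-reachable C A Π s∈RC
... | l , αs⊆R = decidable-stable (_ ≟ᵇ true) (¬¬-bind (¬¬-Rⁱ-stable C A Π) λ stable ¬ψ →
  -- The value of `ψ *` at `s · σX` is that of `ψ` at `⟨ φ ⟩ˢ (s · σX)`, an element of `α s`.
  ¬ψ (trans (eval-subst ψ ≈-refl)
            (ψ-holds _ (stable⇒Rⁱ⊆R C A Π stable l (αs⊆R (σX , ≈-refl))))))
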